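{- Let $t$ be a positive integer. If $G$ is an induced-subgraph-minimal graph having a pivot-minor isomorphic to $P_2+tP_1$, then $|V(G)|\le (t+1)(2^{t+2}-t-2)$.
   Context: Graphs are finite, without loops or multiple edges. $P_2+tP_1$ is the disjoint union of one edge and $t$ isolated vertices. For a vertex $u$ of a graph $G$, the local complementation $G*u$ is obtained from $G$ by complementing the adjacency between every pair of distinct neighbours of $u$. For an edge $uv$ of $G$, the edge pivot is $G\wedge uv=((G*u)*v)*u$. A graph $G$ contains $H$ as a pivot-minor if $H$ can be obtained from $G$ by a sequence of vertex deletions and edge pivots. A graph $G$ is an induced-subgraph-minimal graph having a pivot-minor isomorphic to $H$ if $G$ has a pivot-minor isomorphic to $H$ but no proper induced subgraph of $G$ does. -}

module Defs where

open import Data.Bool.Base using (Bool; true; false; not; _∧_; _xor_)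
open import Data.Bool.Properties using (∧-comm; ∧-assoc; ∧-zeroʳ)
open import Data.Fin.Base using (Fin; zero; suc; punchIn)
open import Data.Fin.Properties using (_≟_; punchIn-injective)
open import Data.Nat.Base using (ℕ; zero; suc; _+_; _<_)
open import Data.Product.Base using (Σ-syntax; ∃-syntax; _×_)
open import Function.Bundles using (_↣_; _↔_; mk↣; module Injection; module Inverse)
open import Relation.Binary.PropositionalEquality
open import Relation.Nullary.Decidable.Core using (does; yes; no)
open import Relation.Nullary.Negation.Core using (¬_; contradiction)

-- A finite simple graph with n vertices, its vertex set labelled by Fin n.
record Graph (n : ℕ) : Set where
  field
    adj     : Fin n → Fin n → Bool
    irrefl  : ∀ x → adj x x ≡ false
    adj-sym : ∀ x y → adj x y ≡ adj y x

open Graph public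

Edge : ∀ {n} → Graph n → Fin n → Fin n → Set
Edge G x y = adj G x y ≡ true

-- The subgraph of G induced on the image of f, with its vertices relabelled
-- by Fin m.  Every induced subgraph of G arises this way up to relabelling,
-- and it is proper exactly when m < n.
induced : ∀ {m n} → Graph n → Fin m ↣ Fin n → Graph m
induced G f = record
  { adj     = λ x y → adj G (to x) (to y)
  ; irrefl  = λ x → irrefl G (to x)
  ; adj-sym = λ x y → adj-sym G (to x) (to y)
  }
  where open Injection f using (to)

-- punchIn u is the order-preserving injection of Fin n into Fin (suc n)
-- whose image is everything except u.
deleteVertex : ∀ {n} → Graph (suc n) → Fin (suc n) → Graph n
deleteVertex G u = induced G (mk↣ (punchIn-injective u _ _))

distinct : ∀ {n} → Fin n → Fin n → Bool
distinct x y = not (does (x ≟ y))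

private
  distinct-irrefl : ∀ {n} (x : Fin n) → distinct x x ≡ false
  distinct-irrefl x with x ≟ x
  ... | yes _  = refl
  ... | no x≢x = contradiction refl x≢x

  distinct-sym : ∀ {n} (x y : Fin n) → distinct x y ≡ distinct y x
  distinct-sym x y with x ≟ y | y ≟ x
  ... | yes _   | yes _   = refl
  ... | no _    | no _    = refl
  ... | yes x≡y | no y≢x  = contradiction (sym x≡y) y≢x
  ... | no x≢y  | yes y≡x = contradiction (sym y≡x) x≢y

  ∧-swap : ∀ a b c → a ∧ b ∧ c ≡ b ∧ a ∧ c
  ∧-swap a b c = trans (sym (∧-assoc a b c))
    (trans (cong (_∧ c) (∧-comm a b)) (∧-assoc b a c))

infixl 7 _*ᴳ_

_*ᴳ_ : ∀ {n} → Graph n → Fin n → Graph n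
_*ᴳ_ {n} G u = record
  { adj     = λ x y → adj G x y xor toggled x y
  ; irrefl  = λ x → cong₂ _xor_ (irrefl G x) (toggled-irrefl x)
  ; adj-sym = λ x y → cong₂ _xor_ (adj-sym G x y) (toggled-sym x y)
  }
  where
  toggled : Fin n → Fin n → Bool
  toggled x y = adj G u x ∧ adj G u y ∧ distinct x y

  toggled-irrefl : ∀ x → toggled x x ≡ false
  toggled-irrefl x rewrite distinct-irrefl x | ∧-zeroʳ (adj G u x) =
    ∧-zeroʳ (adj G u x)

  toggled-sym : ∀ x y → toggled x y ≡ toggled y x
  toggled-sym x y rewrite distinct-sym x y =
    ∧-swap (adj G u x) (adj G u y) (distinct y x)

edgePivot : ∀ {n} (G : Graph n) (u v : Fin n) → Edge G u v → Graph n
edgePivot G u v _ = ((G *ᴳ u) *ᴳ v) *ᴳ u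

data _ObtainedFrom_ : ∀ {m n} → Graph m → Graph n → Set where
  start  : ∀ {n} {G : Graph n} → G ObtainedFrom G
  delete : ∀ {m n} {H : Graph (suc m)} {G : Graph n} →
           H ObtainedFrom G → (u : Fin (suc m)) →
           deleteVertex H u ObtainedFrom G
  pivot  : ∀ {m n} {H : Graph m} {G : Graph n} →
           H ObtainedFrom G → (u v : Fin m) (uv : Edge H u v) →
           edgePivot H u v uv ObtainedFrom G

infix 4 _≅_

_≅_ : ∀ {m n} → Graph m → Graph n → Set
_≅_ {m} {n} G H = Σ[ f ∈ Fin m ↔ Fin n ]
  (∀ x y → adj G x y ≡ adj H (Inverse.to f x) (Inverse.to f y))

HasPivotMinor : ∀ {n k} → Graph n → Graph k → Set
HasPivotMinor G H =
  ∃[ m ] Σ[ H′ ∈ Graph m ] (H′ ObtainedFrom G × H′ ≅ H)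

InducedSubgraphMinimal : ∀ {n k} → Graph n → Graph k → Set
InducedSubgraphMinimal {n} G H =
  HasPivotMinor G H ×
  (∀ {m} → m < n → (f : Fin m ↣ Fin n) → ¬ HasPivotMinor (induced G f) H)

-- The single edge joins the vertices 0 and 1.
P₂+_P₁ : (t : ℕ) → Graph (2 + t)
P₂+ t P₁ = record { adj = a ; irrefl = a-irrefl ; adj-sym = a-sym }
  where
  a : Fin (2 + t) → Fin (2 + t) → Bool
  a zero       (suc zero) = true
  a (suc zero) zero       = true
  a _          _          = false

  a-irrefl : ∀ x → a x x ≡ false
  a-irrefl zero          = refl
  a-irrefl (suc zero)    = refl
  a-irrefl (suc (suc _)) = refl

  a-sym : ∀ x y → a x y ≡ a y x
  a-sym zero          zero          = refl
  a-sym zero          (suc zero)    = refl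
  a-sym zero          (suc (suc _)) = refl
  a-sym (suc zero)    zero          = refl
  a-sym (suc zero)    (suc zero)    = refl
  a-sym (suc zero)    (suc (suc _)) = refl
  a-sym (suc (suc _)) zero          = refl
  a-sym (suc (suc _)) (suc zero)    = refl
  a-sym (suc (suc _)) (suc (suc _)) = refl

module Submission where

-- Forget the order of the pivots: over GF(2), a sequence of edge pivots from G
-- to G′ exchanges the coordinates in some set X of vertices between x and A x,
-- and conversely every such exchange comes from pivots inside X.  Hence, if G
-- is minimal and G′ induces a copy S of P₂ + tP₁, every vertex outside S lies
-- in X, and this remains true after any further pivots.
-- Choose an end a of the edge of S that is not in X (exchange the ends, or
-- pivot the edge, if necessary); then no pivots of G′ avoiding a produce a
-- copy avoiding a.  Group the vertices outside S by their neighbourhoods in S.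
-- Each group is independent, since pivoting an edge inside it would not affect
-- S.  A group with a neighbour in S - a has two of them, and its members are
-- common neighbours of these two, so that there are at most t members: with
-- t + 1, pivoting would produce a copy avoiding a.  The one remaining group,
-- with the single neighbour a, has at most 3t - 2 members, since its members
-- are distinguished by their other neighbours.  With the t + 2 vertices of S
-- this makes at most (t + 2) + t (2^(t+2) - 2) + (3t - 2) vertices.

open import Defs
open import Algebra.Bundles using (CommutativeRing)
open import Data.Bool.Base using (Bool; true; false; not; _∧_; _xor_; if_then_else_)
open import Data.Bool.Properties
  using ( xor-∧-commutativeRing; xor-comm; xor-identityʳ; xor-same
        ; ∧-zeroʳ; ∧-comm; ∧-conicalˡ; ∧-conicalʳ; ¬-not )
  renaming (_≟_ to _≟ᵇ_)
open import Data.Bool.Solver using (module xor-∧-Solver)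
open import Data.Empty using (⊥; ⊥-elim)
open import Data.Fin.Base using (Fin; zero; suc; punchIn; punchOut)
open import Data.Fin.Properties
  using ( _≟_; any?; all?; ¬∀⟶∃¬; suc-injective; 0≢1+n; injective⇒≤; ¬Fin0
        ; punchIn-injective; punchInᵢ≢i; punchOut-injective; punchIn-punchOut )
open import Data.Nat.Base using (ℕ; zero; suc; _+_; _*_; _∸_; _^_; _≤_; _<_; z≤n; s≤s; s≤s⁻¹)
open import Data.Nat.Properties hiding (_≟_; 0≢1+n; suc-injective)
open import Data.Nat.Solver using (module +-*-Solver)
open import Data.Product.Base using (Σ-syntax; ∃-syntax; _×_; _,_; proj₁; proj₂)
open import Data.Vec.Functional using (insertAt)
open import Data.Vec.Functional.Properties using (insertAt-lookup; insertAt-punchIn)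
open import Function.Base using (_∘_)
open import Function.Bundles using (module Inverse; mk↔ₛ′; mk↣)
open import Function.Definitions using (Injective)
open import Relation.Binary.PropositionalEquality
open import Relation.Nullary.Decidable.Core using (Dec; does; yes; no)
open import Relation.Nullary.Negation.Core using (¬_; contradiction)

open import Algebra.Properties.CommutativeSemigroup +-commutativeSemigroup
  using (interchange)
open import Algebra.Properties.Semiring.Sum
  (CommutativeRing.semiring xor-∧-commutativeRing)
  using (sum; sum-cong-≗; ∑-distrib-+; *-distribˡ-sum; sum-remove)

-- Linear algebra over GF(2)

infix 7 _·_

_·_ : ∀ {n} → (Fin n → Bool) → (Fin n → Bool) → Bool
x · y = sum (λ i → x i ∧ y i)

ind : ∀ {n} → Fin n → Fin n → Bool
ind u x = does (u ≟ x)

ind-refl : ∀ {n} (u : Fin n) → ind u u ≡ true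
ind-refl u with u ≟ u
... | yes _   = refl
... | no u≢u  = contradiction refl u≢u

ind-≢ : ∀ {n} {u x : Fin n} → u ≢ x → ind u x ≡ false
ind-≢ {u = u} {x} u≢x with u ≟ x
... | yes u≡x = contradiction u≡x u≢x
... | no _    = refl

ind-injective : ∀ {m n} (f : Fin m → Fin n) → Injective _≡_ _≡_ f →
  ∀ u x → ind (f u) (f x) ≡ ind u x
ind-injective f f-inj u x with u ≟ x
... | yes refl = ind-refl (f u)
... | no u≢x   = ind-≢ (u≢x ∘ f-inj)

sum-false : ∀ n → sum {n} (λ _ → false) ≡ false
sum-false zero    = refl
sum-false (suc n) = sum-false n

·-cong : ∀ {n} {x x′ y y′ : Fin n → Bool} →
  (∀ i → x i ≡ x′ i) → (∀ i → y i ≡ y′ i) → x · y ≡ x′ · y′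
·-cong p q = sum-cong-≗ (λ i → cong₂ _∧_ (p i) (q i))

·-congʳ : ∀ {n} (x : Fin n → Bool) {y y′ : Fin n → Bool} →
  (∀ i → y i ≡ y′ i) → x · y ≡ x · y′
·-congʳ x = ·-cong {x = x} (λ _ → refl)

·-comm : ∀ {n} (x y : Fin n → Bool) → x · y ≡ y · x
·-comm x y = sum-cong-≗ (λ i → ∧-comm (x i) (y i))

·-disjoint : ∀ {n} (x y : Fin n → Bool) → (∀ i → x i ∧ y i ≡ false) → x · y ≡ false
·-disjoint {n} x y xy≡0 = trans (sum-cong-≗ xy≡0) (sum-false n)

·-zeroˡ : ∀ {n} {x : Fin n → Bool} (y : Fin n → Bool) →
  (∀ i → x i ≡ false) → x · y ≡ false
·-zeroˡ {x = x} y x≡0 = ·-disjoint x y (λ i → cong (_∧ y i) (x≡0 i))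

·-distribʳ : ∀ {n} (x y z : Fin n → Bool) →
  (λ i → x i xor y i) · z ≡ x · z xor y · z
·-distribʳ x y z = trans
  (sum-cong-≗ (λ i → solve 3 (λ a b c → (a :+ b) :* c := a :* c :+ b :* c) refl (x i) (y i) (z i)))
  (∑-distrib-+ (λ i → x i ∧ z i) (λ i → y i ∧ z i))
  where open xor-∧-Solver

·-scaleˡ : ∀ {n} c (x y : Fin n → Bool) → (λ i → c ∧ x i) · y ≡ c ∧ x · y
·-scaleˡ c x y = trans
  (sum-cong-≗ (λ i → solve 3 (λ a b d → (a :* b) :* d := a :* (b :* d)) refl c (x i) (y i)))
  (sym (*-distribˡ-sum c (λ i → x i ∧ y i)))
  where open xor-∧-Solver

·-distribˡ : ∀ {n} (x y z : Fin n → Bool) →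
  x · (λ i → y i xor z i) ≡ x · y xor x · z
·-distribˡ x y z = trans (·-comm x _) (trans (·-distribʳ y z x)
  (cong₂ _xor_ (·-comm y x) (·-comm z x)))

·-scaleʳ : ∀ {n} c (x y : Fin n → Bool) → x · (λ i → c ∧ y i) ≡ c ∧ x · y
·-scaleʳ c x y = trans (·-comm x _) (trans (·-scaleˡ c y x) (cong (c ∧_) (·-comm y x)))

ind-· : ∀ {n} (u : Fin n) (x : Fin n → Bool) → ind u · x ≡ x u
ind-· {suc n} u x = begin
  ind u · x
    ≡⟨ sum-remove {i = u} (λ i → ind u i ∧ x i) ⟩
  (ind u u ∧ x u) xor (ind u ∘ punchIn u) · (x ∘ punchIn u)
    ≡⟨ cong₂ _xor_ (cong (_∧ x u) (ind-refl u))
         (·-zeroˡ (x ∘ punchIn u) (λ i → ind-≢ (punchInᵢ≢i u i ∘ sym))) ⟩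
  x u xor false
    ≡⟨ xor-identityʳ (x u) ⟩
  x u ∎
  where open ≡-Reasoning

·-ind : ∀ {n} (x : Fin n → Bool) (u : Fin n) → x · ind u ≡ x u
·-ind x u = trans (·-comm x (ind u)) (ind-· u x)

-- Edge pivots as matrix updates and as exchanges of coordinates

pvec : ∀ {n} → Graph n → Fin n → Fin n → Bool
pvec G u x = adj G u x xor ind u x

-- The adjacency matrix of G ∧ uv is A + αβᵀ + βαᵀ with α = row u + e_u and
-- β = row v + e_v.
pivotAdj : ∀ {n} → Graph n → (u v x y : Fin n) → Bool
pivotAdj G u v x y =
  adj G x y xor ((pvec G u x ∧ pvec G v y) xor (pvec G v x ∧ pvec G u y))

edge⇒≢ : ∀ {n} (G : Graph n) {u v} → Edge G u v → u ≢ v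
edge⇒≢ G {u} uv refl with trans (sym uv) (irrefl G u)
... | ()

-- Complementing at the neighbour u adds row u to row v. The diagonal entry must stay 0 although
-- `adj G u v` is 1, and the `ind v` inside `pvec G v` repairs it.
adj-*u : ∀ {n} (G : Graph n) {u v} → Edge G u v → ∀ x →
  adj (G *ᴳ u) v x ≡ adj G u x xor pvec G v x
adj-*u G {u} {v} uv x with v ≟ x
... | yes refl rewrite uv | irrefl G v = refl
... | no _     rewrite uv =
  solve 2 (λ p q → q :+ p :* con true := p :+ (q :+ con false)) refl (adj G u x) (adj G v x)
  where open xor-∧-Solver

adj-*u*v : ∀ {n} (G : Graph n) {u v} → Edge G u v → ∀ x →
  adj (G *ᴳ u *ᴳ v) u x ≡ pvec G v x xor ind u x
adj-*u*v G {u} {v} uv x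
  rewrite adj-*u G uv x | adj-*u G uv u
        | irrefl G u | ind-≢ (edge⇒≢ G uv ∘ sym) | trans (adj-sym G v u) uv
  with u ≟ x
... | yes refl rewrite irrefl G u | ind-≢ (edge⇒≢ G uv ∘ sym) | trans (adj-sym G v u) uv = refl
... | no _ =
  solve 2 (λ p b → (p :+ con false) :+ (p :+ b) :* con true := b :+ con false) refl
    (adj G u x) (pvec G v x)
  where open xor-∧-Solver

ind-∧ : ∀ {n} (u : Fin n) {x y} → x ≢ y → ind u x ∧ ind u y ≡ false
ind-∧ u {x} {y} x≢y with u ≟ x
... | no _     = refl
... | yes refl = ind-≢ x≢y

-- The three complementations toggle along row u of `G`, row v of `G *ᴳ u` and row u of
-- `G *ᴳ u *ᴳ v`; the last two are computed above. Off the diagonal, multiplying out gives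
-- `pivotAdj` plus the single term `ind u x ∧ ind u y`, which vanishes there.
adj-edgePivot : ∀ {n} (G : Graph n) u v (uv : Edge G u v) x y →
  adj (edgePivot G u v uv) x y ≡ pivotAdj G u v x y
adj-edgePivot {n} G u v uv x y = by (x ≟ y)
  where
  open xor-∧-Solver

  by : Dec (x ≡ y) → adj (edgePivot G u v uv) x y ≡ pivotAdj G u v x y
  by (yes refl) = trans (irrefl (edgePivot G u v uv) x) (sym (trans
    (cong (_xor (pvec G u x ∧ pvec G v x xor pvec G v x ∧ pvec G u x)) (irrefl G x))
    (trans (cong (pvec G u x ∧ pvec G v x xor_) (∧-comm (pvec G v x) (pvec G u x)))
      (xor-same (pvec G u x ∧ pvec G v x)))))
  by (no x≢y)
    rewrite adj-*u*v G uv x | adj-*u*v G uv y | adj-*u G uv x | adj-*u G uv y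
          | ind-≢ x≢y
    = trans
      (solve 7 (λ a p b d r c e →
          ((a :+ p :* (r :* con true)) :+ (p :+ b) :* ((r :+ c) :* con true))
            :+ (b :+ d) :* ((c :+ e) :* con true)
        := (a :+ ((p :+ d) :* c :+ b :* (r :+ e))) :+ d :* e) refl
        (adj G x y) (adj G u x) (pvec G v x) (ind u x)
        (adj G u y) (pvec G v y) (ind u y))
      (trans (cong (pivotAdj G u v x y xor_) (ind-∧ u x≢y)) (xor-identityʳ _))

-- The principal pivot transform: with A, A′ the adjacency matrices over GF(2),
-- exchanging the X-coordinates of x and y maps the solutions of y = A x to
-- those of y = A′ x.  This is what remains of a sequence of edge pivots when
-- the order of the pivots is forgotten.
select : ∀ {n} → (X x y : Fin n → Bool) → Fin n → Bool
select X x y i = if X i then y i else x i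

_⊛_ : ∀ {n} → Graph n → (Fin n → Bool) → Fin n → Bool
(G ⊛ x) i = adj G i · x

record Transform {n} (G : Graph n) (X : Fin n → Bool) (G′ : Graph n) : Set where
  constructor mkTransform
  field
    exchange : ∀ x i → (G′ ⊛ select X x (G ⊛ x)) i ≡ select X (G ⊛ x) x i

open Transform

⊛-cong : ∀ {n} (G : Graph n) {x y} → (∀ i → x i ≡ y i) → ∀ i → (G ⊛ x) i ≡ (G ⊛ y) i
⊛-cong G x≗y i = ·-congʳ (adj G i) x≗y

transform-resp : ∀ {n} {G G′ : Graph n} {X Y} →
  (∀ i → X i ≡ Y i) → Transform G X G′ → Transform G Y G′
transform-resp {G = G} {G′} {X} {Y} X≗Y T .exchange x i = begin
  (G′ ⊛ select Y x (G ⊛ x)) i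
    ≡⟨ ⊛-cong G′ (λ j → cong (λ b → if b then (G ⊛ x) j else x j) (sym (X≗Y j))) i ⟩
  (G′ ⊛ select X x (G ⊛ x)) i ≡⟨ exchange T x i ⟩
  select X (G ⊛ x) x i
    ≡⟨ cong (λ b → if b then x i else (G ⊛ x) i) (X≗Y i) ⟩
  select Y (G ⊛ x) x i ∎
  where open ≡-Reasoning

transform-refl : ∀ {n} (G : Graph n) → Transform G (λ _ → false) G
transform-refl G .exchange x i = refl

infixl 6 _△_

_△_ : ∀ {n} → (X Y : Fin n → Bool) → Fin n → Bool
(X △ Y) i = X i xor Y i

-- A coordinate exchanged in both steps is back in its place, whence the symmetric difference. The
-- second exchange is applied to the vector `x′` produced by the first, whose image under `G′` is
-- known from `T`.
transform-trans : ∀ {n} {G G′ G″ : Graph n} {X Y} →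
  Transform G X G′ → Transform G′ Y G″ → Transform G (X △ Y) G″
transform-trans {G = G} {G′} {G″} {X} {Y} T T′ .exchange x i = begin
  (G″ ⊛ select (X △ Y) x y) i                 ≡⟨ ⊛-cong G″ x″≗ i ⟩
  (G″ ⊛ select Y x′ (G′ ⊛ x′)) i              ≡⟨ exchange T′ x′ i ⟩
  (if Y i then x′ i else (G′ ⊛ x′) i)         ≡⟨ cong (if Y i then x′ i else_) (exchange T x i) ⟩
  (if Y i then x′ i else select X y x i)      ≡⟨ merge (X i) (Y i) ⟩
  select (X △ Y) y x i                        ∎
  where
  open ≡-Reasoning
  y x′ : Fin _ → Bool
  y  = G ⊛ x
  x′ = select X x y

  merge : ∀ b c {p q : Bool} →
    (if c then (if b then p else q) else (if b then q else p)) ≡ (if b xor c then q else p)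
  merge true  true  = refl
  merge true  false = refl
  merge false true  = refl
  merge false false = refl

  x″≗ : ∀ j → select (X △ Y) x y j ≡ select Y x′ (G′ ⊛ x′) j
  x″≗ j = trans (sym (merge (X j) (Y j)))
    (cong (λ b → if Y j then b else x′ j) (sym (exchange T x j)))

pair : ∀ {n} → (u v : Fin n) → Fin n → Bool
pair u v = ind u △ ind v

-- Over GF(2), exchanging x and y at a coordinate adds x + y there. In this form the exchange is a
-- vector sum, and `⊛-shift` can carry it through the adjacency matrix.
select-pair : ∀ {n} {u v : Fin n} → u ≢ v → ∀ x y i →
  select (pair u v) x y i ≡ x i xor (ind u i ∧ (x u xor y u) xor ind v i ∧ (x v xor y v))
select-pair {u = u} {v} u≢v x y i with u ≟ i | v ≟ i
... | yes refl | yes refl = contradiction refl u≢v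
... | yes refl | no _     =
  solve 2 (λ a b → b := a :+ ((a :+ b) :+ con false)) refl (x i) (y i)
  where open xor-∧-Solver
... | no _     | yes refl =
  solve 2 (λ a b → b := a :+ (a :+ b)) refl (x i) (y i)
  where open xor-∧-Solver
... | no _     | no _     = sym (xor-identityʳ (x i))

⊛-shift : ∀ {n} (G : Graph n) x (u v : Fin n) p q i →
  (G ⊛ (λ j → x j xor (ind u j ∧ p xor ind v j ∧ q))) i ≡
  (G ⊛ x) i xor (p ∧ adj G u i xor q ∧ adj G v i)
⊛-shift G x u v p q i = trans (·-distribˡ (adj G i) x _) (cong ((G ⊛ x) i xor_)
  (trans (·-distribˡ (adj G i) (λ j → ind u j ∧ p) (λ j → ind v j ∧ q))
    (cong₂ _xor_ (column u p) (column v q))))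
  where
  column : ∀ w c → adj G i · (λ j → ind w j ∧ c) ≡ c ∧ adj G w i
  column w c = trans (·-congʳ (adj G i) (λ j → ∧-comm (ind w j) c))
    (trans (·-scaleʳ c (adj G i) (ind w))
      (cong (c ∧_) (trans (·-ind (adj G i) w) (adj-sym G i w))))

pvec-· : ∀ {n} (G : Graph n) u x → pvec G u · x ≡ (G ⊛ x) u xor x u
pvec-· G u x = trans (·-distribʳ (adj G u) (ind u) x) (cong ((G ⊛ x) u xor_) (ind-· u x))

pivot-⊛ : ∀ {n} (G P : Graph n) u v → (∀ x y → adj P x y ≡ pivotAdj G u v x y) → ∀ x i →
  (P ⊛ x) i ≡
  (G ⊛ x) i xor (pvec G u i ∧ pvec G v · x xor pvec G v i ∧ pvec G u · x)
pivot-⊛ G P u v P≗ x i = trans (·-cong (P≗ i) (λ _ → refl))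
  (trans (·-distribʳ (adj G i) (λ j → pvec G u i ∧ pvec G v j xor pvec G v i ∧ pvec G u j) x)
    (cong ((G ⊛ x) i xor_)
    (trans (·-distribʳ (λ j → pvec G u i ∧ pvec G v j) (λ j → pvec G v i ∧ pvec G u j) x)
      (cong₂ _xor_ (·-scaleˡ (pvec G u i) (pvec G v) x) (·-scaleˡ (pvec G v i) (pvec G u) x)))))

module PivotIdentities where

  open xor-∧-Solver

  pivot-eq : ∀ c p q U V d e →
    (c xor (p ∧ U xor q ∧ V)) xor ((U xor d) ∧ p xor (V xor e) ∧ q) ≡ c xor (d ∧ p xor e ∧ q)
  pivot-eq = solve 7 (λ c p q U V d e →
    (c :+ (p :* U :+ q :* V)) :+ ((U :+ d) :* p :+ (V :+ e) :* q) := c :+ (d :* p :+ e :* q)) refl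

  pivot⁻¹-eq : ∀ c a b U V d e →
    c xor (b ∧ U xor a ∧ V) ≡
    (c xor ((U xor d) ∧ b xor (V xor e) ∧ a)) xor (d ∧ b xor e ∧ a)
  pivot⁻¹-eq = solve 7 (λ c a b U V d e →
    c :+ (b :* U :+ a :* V) :=
    (c :+ ((U :+ d) :* b :+ (V :+ e) :* a)) :+ (d :* b :+ e :* a)) refl

  α-eq : ∀ c p q → (c xor (p ∧ false xor q ∧ true)) xor (c xor false) ≡ q
  α-eq = solve 3 (λ c p q →
    (c :+ (p :* con false :+ q :* con true)) :+ (c :+ con false) := q) refl

  β-eq : ∀ c p q → (c xor (p ∧ true xor q ∧ false)) xor (c xor false) ≡ p
  β-eq = solve 3 (λ c p q →
    (c :+ (p :* con true :+ q :* con false)) :+ (c :+ con false) := p) refl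

  yu-eq : ∀ s c b → s xor (c xor (true ∧ b xor true ∧ (c xor s))) ≡ b
  yu-eq = solve 3 (λ s c b →
    s :+ (c :+ (con true :* b :+ con true :* (c :+ s))) := b) refl

  yv-eq : ∀ s c a → s xor (c xor (true ∧ (c xor s) xor true ∧ a)) ≡ a
  yv-eq = solve 3 (λ s c a →
    s :+ (c :+ (con true :* (c :+ s) :+ con true :* a)) := a) refl

open PivotIdentities

module _ {n} (G G⋀ : Graph n) (u v : Fin n) (uv : Edge G u v)
  (G⋀≗ : ∀ x y → adj G⋀ x y ≡ pivotAdj G u v x y) where

  private
    u≢v : u ≢ v
    u≢v = edge⇒≢ G uv

    vu : Edge G v u
    vu = trans (adj-sym G v u) uv

    pvec-uu : pvec G u u ≡ true
    pvec-uu = cong₂ _xor_ (irrefl G u) (ind-refl u)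

    pvec-vv : pvec G v v ≡ true
    pvec-vv = cong₂ _xor_ (irrefl G v) (ind-refl v)

    pvec-uv : pvec G u v ≡ true
    pvec-uv = cong₂ _xor_ uv (ind-≢ u≢v)

    pvec-vu : pvec G v u ≡ true
    pvec-vu = cong₂ _xor_ vu (ind-≢ (u≢v ∘ sym))

    select-u : ∀ (x y : Fin n → Bool) → select (pair u v) x y u ≡ y u
    select-u x y = cong (λ b → if b then y u else x u) (cong₂ _xor_ (ind-refl u) (ind-≢ (u≢v ∘ sym)))

    select-v : ∀ (x y : Fin n → Bool) → select (pair u v) x y v ≡ y v
    select-v x y = cong (λ b → if b then y v else x v) (cong₂ _xor_ (ind-≢ u≢v) (ind-refl v))

  -- Moving from x to x′ adds p times row u and q times row v to `G ⊛ x`. Since α · x′ = q and β ·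
  -- x′ = p for α = `pvec G u` and β = `pvec G v`, the rank-two correction adds pα + qβ. The rows
  -- cancel and p e_u + q e_v is left, which is the exchange at u and v.
  transform-pivot : Transform G (pair u v) G⋀
  transform-pivot .exchange x i = begin
    (G⋀ ⊛ x′) i
      ≡⟨ pivot-⊛ G G⋀ u v G⋀≗ x′ i ⟩
    (G ⊛ x′) i xor (pvec G u i ∧ pvec G v · x′ xor pvec G v i ∧ pvec G u · x′)
      ≡⟨ cong₂ _xor_ (Gx′ i) (cong₂ (λ a b → pvec G u i ∧ a xor pvec G v i ∧ b) β·x′ α·x′) ⟩
    (y i xor (p ∧ adj G u i xor q ∧ adj G v i)) xor (pvec G u i ∧ p xor pvec G v i ∧ q)
      ≡⟨ pivot-eq (y i) p q (adj G u i) (adj G v i) (ind u i) (ind v i) ⟩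
    y i xor (ind u i ∧ p xor ind v i ∧ q)
      ≡⟨ cong₂ (λ a b → y i xor (ind u i ∧ a xor ind v i ∧ b))
           (xor-comm (x u) (y u)) (xor-comm (x v) (y v)) ⟩
    y i xor (ind u i ∧ (y u xor x u) xor ind v i ∧ (y v xor x v))
      ≡⟨ select-pair u≢v y x i ⟨
    select (pair u v) y x i ∎
    where
    open ≡-Reasoning
    y x′ : Fin n → Bool
    y  = G ⊛ x
    x′ = select (pair u v) x y
    p q : Bool
    p = x u xor y u
    q = x v xor y v

    Gx′ : ∀ j → (G ⊛ x′) j ≡ y j xor (p ∧ adj G u j xor q ∧ adj G v j)
    Gx′ j = trans (⊛-cong G (select-pair u≢v x y) j) (⊛-shift G x u v p q j)

    α·x′ : pvec G u · x′ ≡ q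
    α·x′ = begin
      pvec G u · x′
        ≡⟨ pvec-· G u x′ ⟩
      (G ⊛ x′) u xor x′ u
        ≡⟨ cong₂ _xor_
             (trans (Gx′ u) (cong₂ (λ a b → y u xor (p ∧ a xor q ∧ b)) (irrefl G u) vu))
             (trans (select-u x y) (sym (xor-identityʳ (y u)))) ⟩
      (y u xor (p ∧ false xor q ∧ true)) xor (y u xor false)
        ≡⟨ α-eq (y u) p q ⟩
      q ∎

    β·x′ : pvec G v · x′ ≡ p
    β·x′ = begin
      pvec G v · x′
        ≡⟨ pvec-· G v x′ ⟩
      (G ⊛ x′) v xor x′ v
        ≡⟨ cong₂ _xor_
             (trans (Gx′ v) (cong₂ (λ a b → y v xor (p ∧ a xor q ∧ b)) uv (irrefl G v)))
             (trans (select-v x y) (sym (xor-identityʳ (y v)))) ⟩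
      (y v xor (p ∧ true xor q ∧ false)) xor (y v xor false)
        ≡⟨ β-eq (y v) p q ⟩
      p ∎

  -- The same cancellation read backwards: here b and a are β · x and α · x, and α and β are both 1
  -- at u and at v, so that x and y differ by b at u and by a at v. This direction lets a pivot be
  -- split off the front of an exchange.
  transform-pivot⁻¹ : Transform G⋀ (pair u v) G
  transform-pivot⁻¹ .exchange x i = begin
    (G ⊛ select (pair u v) x y) i
      ≡⟨ ⊛-cong G (select-pair u≢v x y) i ⟩
    (G ⊛ (λ j → x j xor (ind u j ∧ (x u xor y u) xor ind v j ∧ (x v xor y v)))) i
      ≡⟨ ⊛-shift G x u v (x u xor y u) (x v xor y v) i ⟩
    z i xor ((x u xor y u) ∧ adj G u i xor (x v xor y v) ∧ adj G v i)
      ≡⟨ cong₂ (λ c d → z i xor (c ∧ adj G u i xor d ∧ adj G v i)) yu yv ⟩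
    z i xor (b ∧ adj G u i xor a ∧ adj G v i)
      ≡⟨ pivot⁻¹-eq (z i) a b (adj G u i) (adj G v i) (ind u i) (ind v i) ⟩
    (z i xor (pvec G u i ∧ b xor pvec G v i ∧ a)) xor (ind u i ∧ b xor ind v i ∧ a)
      ≡⟨ cong₂ _xor_ (sym (y≗ i)) (cong₂ (λ c d → ind u i ∧ c xor ind v i ∧ d)
            (trans (sym yu) (xor-comm (x u) (y u))) (trans (sym yv) (xor-comm (x v) (y v)))) ⟩
    y i xor (ind u i ∧ (y u xor x u) xor ind v i ∧ (y v xor x v))
      ≡⟨ select-pair u≢v y x i ⟨
    select (pair u v) y x i ∎
    where
    open ≡-Reasoning
    y z : Fin n → Bool
    y = G⋀ ⊛ x
    z = G ⊛ x
    a b : Bool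
    a = z u xor x u
    b = z v xor x v

    y≗ : ∀ j → y j ≡ z j xor (pvec G u j ∧ b xor pvec G v j ∧ a)
    y≗ j = trans (pivot-⊛ G G⋀ u v G⋀≗ x j)
      (cong₂ (λ c d → z j xor (pvec G u j ∧ c xor pvec G v j ∧ d)) (pvec-· G v x) (pvec-· G u x))

    yu : x u xor y u ≡ b
    yu = trans (cong (x u xor_) (trans (y≗ u)
        (cong₂ (λ c d → z u xor (c ∧ b xor d ∧ a)) pvec-uu pvec-vu)))
      (yu-eq (x u) (z u) b)

    yv : x v xor y v ≡ a
    yv = trans (cong (x v xor_) (trans (y≗ v)
        (cong₂ (λ c d → z v xor (c ∧ b xor d ∧ a)) pvec-uv pvec-vv)))
      (yv-eq (x v) (z v) a)

transform-edgePivot : ∀ {n} (G : Graph n) u v (uv : Edge G u v) →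
  Transform G (pair u v) (edgePivot G u v uv)
transform-edgePivot G u v uv =
  transform-pivot G (edgePivot G u v uv) u v uv (adj-edgePivot G u v uv)

transform-edgePivot⁻¹ : ∀ {n} (G : Graph n) u v (uv : Edge G u v) →
  Transform (edgePivot G u v uv) (pair u v) G
transform-edgePivot⁻¹ G u v uv =
  transform-pivot⁻¹ G (edgePivot G u v uv) u v uv (adj-edgePivot G u v uv)

⊛-delete : ∀ {n} (G : Graph (suc n)) v x → x v ≡ false → ∀ j →
  (deleteVertex G v ⊛ (x ∘ punchIn v)) j ≡ (G ⊛ x) (punchIn v j)
⊛-delete G v x xv j = sym (trans (sum-remove {i = v} (λ k → adj G (punchIn v j) k ∧ x k))
  (cong (_xor (deleteVertex G v ⊛ (x ∘ punchIn v)) j)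
    (trans (cong (adj G (punchIn v j) v ∧_) xv) (∧-zeroʳ _))))

-- Extend x by 0 at v. Because v is off `X`, the exchanged vector is also 0 at v, so column v
-- contributes to neither product.
transform-delete : ∀ {n} {G G′ : Graph (suc n)} {X} v → X v ≡ false → Transform G X G′ →
  Transform (deleteVertex G v) (X ∘ punchIn v) (deleteVertex G′ v)
transform-delete {n} {G} {G′} {X} v Xv T .exchange x i = begin
  (deleteVertex G′ v ⊛ select (X ∘ punchIn v) x (deleteVertex G v ⊛ x)) i
    ≡⟨ ⊛-cong (deleteVertex G′ v)
         (λ j → cong₂ (λ b c → if X (punchIn v j) then b else c) (Gx j) (x≗ j)) i ⟩
  (deleteVertex G′ v ⊛ (select X x̂ (G ⊛ x̂) ∘ punchIn v)) i
    ≡⟨ ⊛-delete G′ v (select X x̂ (G ⊛ x̂)) x′v i ⟩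
  (G′ ⊛ select X x̂ (G ⊛ x̂)) (punchIn v i)
    ≡⟨ exchange T x̂ (punchIn v i) ⟩
  select X (G ⊛ x̂) x̂ (punchIn v i)
    ≡⟨ cong₂ (λ b c → if X (punchIn v i) then b else c) (x≗ i) (Gx i) ⟨
  select (X ∘ punchIn v) (deleteVertex G v ⊛ x) x i ∎
  where
  open ≡-Reasoning
  x̂ : Fin (suc n) → Bool
  x̂ = insertAt x v false

  x≗ : ∀ j → x j ≡ x̂ (punchIn v j)
  x≗ j = sym (insertAt-punchIn x v false j)

  Gx : ∀ j → (deleteVertex G v ⊛ x) j ≡ (G ⊛ x̂) (punchIn v j)
  Gx j = trans (⊛-cong (deleteVertex G v) x≗ j)
    (⊛-delete G v x̂ (insertAt-lookup x v false) j)

  x′v : select X x̂ (G ⊛ x̂) v ≡ false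
  x′v rewrite Xv = insertAt-lookup x v false

-- Pivot-minors as an exchange followed by an embedding

record Embeds {m n} (H : Graph m) (G : Graph n) (f : Fin m → Fin n) : Set where
  constructor _,_
  field
    injective : Injective _≡_ _≡_ f
    adj-≡     : ∀ x y → adj H x y ≡ adj G (f x) (f y)

pivotAdj-embeds : ∀ {m n} {H : Graph m} {G : Graph n} {f} → Embeds H G f → ∀ u v x y →
  pivotAdj H u v x y ≡ pivotAdj G (f u) (f v) (f x) (f y)
pivotAdj-embeds {H = H} {G} {f} (f-inj , f-adj) u v x y = cong₂ _xor_ (f-adj x y)
  (cong₂ _xor_ (cong₂ _∧_ (pv u x) (pv v y)) (cong₂ _∧_ (pv v x) (pv u y)))
  where
  pv : ∀ u x → pvec H u x ≡ pvec G (f u) (f x)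
  pv u x = cong₂ _xor_ (f-adj u x) (sym (ind-injective f f-inj u x))

-- All deletions are postponed to the end: the exchange takes place on the full vertex set of `G`,
-- and the vertices off the image of `f` are the deleted ones.
record PivotMinorData {k n} (G : Graph n) (H : Graph k) : Set where
  constructor mk
  field
    X         : Fin n → Bool
    G′        : Graph n
    transform : Transform G X G′
    f         : Fin k → Fin n
    embeds    : Embeds H G′ f

-- A deletion only restricts `f`. A pivot of `H` is carried out along `f` in the larger graph; by
-- `pivotAdj` the new adjacency of two vertices depends only on adjacencies among them and the
-- pivoted ends, so it agrees on the image.
obtained⇒data : ∀ {m n} {H : Graph m} {G : Graph n} → H ObtainedFrom G → PivotMinorData G H
obtained⇒data {G = G} start = mk _ G (transform-refl G) _ ((λ eq → eq) , λ _ _ → refl)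
obtained⇒data (delete o u) with obtained⇒data o
... | mk X G′ T f (f-inj , f-adj) = mk X G′ T (f ∘ punchIn u)
  ((λ eq → punchIn-injective u _ _ (f-inj eq)) , λ x y → f-adj (punchIn u x) (punchIn u y))
obtained⇒data {n = n} (pivot {H = H} o u v uv) with obtained⇒data o
... | mk X G′ T f e@(f-inj , f-adj) =
  mk (X △ pair (f u) (f v)) (edgePivot G′ (f u) (f v) uv′)
    (transform-trans {G″ = edgePivot G′ (f u) (f v) uv′} T (transform-edgePivot G′ (f u) (f v) uv′))
    f
    (f-inj , λ x y → trans (adj-edgePivot H u v uv x y)
      (trans (pivotAdj-embeds {H = H} {G′} e u v x y)
        (sym (adj-edgePivot G′ (f u) (f v) uv′ (f x) (f y)))))
  where
  uv′ : Edge G′ (f u) (f v)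
  uv′ = trans (sym (f-adj u v)) uv

hasPivotMinor⇒data : ∀ {n k} {G : Graph n} {H : Graph k} → HasPivotMinor G H → PivotMinorData G H
hasPivotMinor⇒data {H = H} (m , H′ , o , φ , φ-adj) with obtained⇒data o
... | mk X G′ T f (f-inj , f-adj) = mk X G′ T (f ∘ from)
  ( (λ {x} {y} eq → trans (sym (strictlyInverseˡ x)) (trans (cong to (f-inj eq)) (strictlyInverseˡ y)))
  , λ x y → trans (sym (trans (φ-adj (from x) (from y))
      (cong₂ (adj H) (strictlyInverseˡ x) (strictlyInverseˡ y)))) (f-adj (from x) (from y)))
  where open Inverse φ using (to; from; strictlyInverseˡ)

obtained-trans : ∀ {k m n} {K : Graph k} {H : Graph m} {G : Graph n} →
  K ObtainedFrom H → H ObtainedFrom G → K ObtainedFrom G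
obtained-trans start          o = o
obtained-trans (delete p u)   o = delete (obtained-trans p o) u
obtained-trans (pivot p u v e) o = pivot (obtained-trans p o) u v e

hasPivotMinor-obtained : ∀ {k m n} {K : Graph k} {H : Graph m} {G : Graph n} →
  H ObtainedFrom G → HasPivotMinor H K → HasPivotMinor G K
hasPivotMinor-obtained o (m , K′ , o′ , iso) = m , K′ , obtained-trans o′ o , iso

embeds-delete : ∀ {k n} {H : Graph k} {G : Graph (suc n)} {f} → Embeds H G f →
  ∀ {v} (v≢f : ∀ i → v ≢ f i) → Embeds H (deleteVertex G v) (λ i → punchOut (v≢f i))
embeds-delete {G = G} (f-inj , f-adj) v≢f =
  (λ eq → f-inj (punchOut-injective (v≢f _) (v≢f _) eq)) ,
  λ x y → trans (f-adj x y)
    (sym (cong₂ (adj G) (punchIn-punchOut (v≢f x)) (punchIn-punchOut (v≢f y))))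

-- Vertices off the image of `f` are deleted one at a time, by recursion on the order of `G`, until
-- `f` is onto and hence an isomorphism.
embeds⇒hasPivotMinor : ∀ {k n} {H : Graph k} {G : Graph n} f → Embeds H G f → HasPivotMinor G H
embeds⇒hasPivotMinor {k} {n} {H} {G} f e@(f-inj , f-adj) =
  by (all? (λ v → any? (λ i → f i ≟ v)))
  where
  omit : ∀ {n} (G : Graph n) {f : Fin k → Fin n} → Embeds H G f →
    ∀ v → ¬ (∃[ i ] f i ≡ v) → HasPivotMinor G H
  omit {suc n} G e v v∉f = hasPivotMinor-obtained {K = H} (delete start v)
    (embeds⇒hasPivotMinor _ (embeds-delete e (λ i v≡fi → v∉f (i , sym v≡fi))))

  by : Dec (∀ v → ∃[ i ] f i ≡ v) → HasPivotMinor G H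
  by (yes f-surj) = n , G , start
    , mk↔ₛ′ to f (λ x → f-inj (proj₂ (f-surj (f x)))) (λ v → proj₂ (f-surj v))
    , λ x y → trans (sym (cong₂ (adj G) (proj₂ (f-surj x)) (proj₂ (f-surj y))))
        (sym (f-adj (to x) (to y)))
    where
    to : Fin n → Fin k
    to v = proj₁ (f-surj v)
  by (no ¬surj) with ¬∀⟶∃¬ n _ (λ v → any? (λ i → f i ≟ v)) ¬surj
  ... | v , v∉f = omit G e v v∉f

-- Counting vertices

count : ∀ {n} → (Fin n → Bool) → ℕ
count {zero}  p = 0
count {suc n} p = (if p zero then 1 else 0) + count (p ∘ suc)

bit-mono : ∀ {b c : Bool} → (b ≡ true → c ≡ true) → (if b then 1 else 0) ≤ (if c then 1 else 0)
bit-mono {false} {c} b⇒c = z≤n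
bit-mono {true} {c} b⇒c rewrite b⇒c refl = ≤-refl

count-mono : ∀ {n} {p q : Fin n → Bool} → (∀ i → p i ≡ true → q i ≡ true) → count p ≤ count q
count-mono {zero}  p⇒q = z≤n
count-mono {suc n} p⇒q = +-mono-≤ (bit-mono (p⇒q zero)) (count-mono (p⇒q ∘ suc))

count-mono-< : ∀ {n} {p q : Fin n → Bool} → (∀ i → p i ≡ true → q i ≡ true) →
  ∀ j → p j ≡ false → q j ≡ true → count p < count q
count-mono-< {suc n} {p} {q} p⇒q zero pj qj rewrite pj | qj = s≤s (count-mono (p⇒q ∘ suc))
count-mono-< {suc n} {p} {q} p⇒q (suc j) pj qj =
  +-mono-≤-< (bit-mono (p⇒q zero)) (count-mono-< (p⇒q ∘ suc) j pj qj)

count-split : ∀ {n} (p q : Fin n → Bool) →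
  count p ≡ count (λ i → p i ∧ q i) + count (λ i → p i ∧ not (q i))
count-split {zero}  p q = refl
count-split {suc n} p q with p zero | q zero
... | false | _     = count-split (p ∘ suc) (q ∘ suc)
... | true  | true  = cong suc (count-split (p ∘ suc) (q ∘ suc))
... | true  | false = trans (cong suc (count-split (p ∘ suc) (q ∘ suc))) (sym (+-suc _ _))

count-true : ∀ n → count {n} (λ _ → true) ≡ n
count-true zero    = refl
count-true (suc n) = cong suc (count-true n)

count-none : ∀ {n} {p : Fin n → Bool} → (∀ i → p i ≡ true → ⊥) → count p ≡ 0
count-none {zero} none = refl
count-none {suc n} {p} none with p zero in eq
... | false = count-none (none ∘ suc)
... | true  = ⊥-elim (none zero eq)

count⇒injection : ∀ {n} k (p : Fin n → Bool) → k ≤ count p →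
  Σ[ f ∈ (Fin k → Fin n) ] Injective _≡_ _≡_ f × (∀ i → p (f i) ≡ true)
count⇒injection {n} zero p k≤ = (λ ()) , (λ { {()} }) , λ ()
count⇒injection {suc n} (suc k) p k≤ with p zero in eq
... | false with count⇒injection (suc k) (p ∘ suc) k≤
...   | f , f-inj , pf = suc ∘ f , (λ e → f-inj (suc-injective e)) , pf
count⇒injection {suc n} (suc k) p k≤ | true with count⇒injection k (p ∘ suc) (s≤s⁻¹ k≤)
...   | f , f-inj , pf = g , g-inj , pg
  where
  g : Fin (suc k) → Fin (suc n)
  g zero    = zero
  g (suc i) = suc (f i)

  g-inj : Injective _≡_ _≡_ g
  g-inj {zero}  {zero}  _ = refl
  g-inj {suc i} {suc j} e = cong suc (f-inj (suc-injective e))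

  pg : ∀ i → p (g i) ≡ true
  pg zero    = eq
  pg (suc i) = pf i

count≤ : ∀ {n} k (p : Fin n → Bool) →
  (∀ (f : Fin (suc k) → Fin n) → Injective _≡_ _≡_ f → (∀ i → p (f i) ≡ true) → ⊥) →
  count p ≤ k
count≤ k p none with suc k ≤? count p
... | no ¬k<      = s≤s⁻¹ (≰⇒> ¬k<)
... | yes k<  with count⇒injection (suc k) p k<
...   | f , f-inj , pf = ⊥-elim (none f f-inj pf)

count-image : ∀ {m n} (f : Fin m → Fin n) (p : Fin n → Bool) →
  (∀ v → p v ≡ true → ∃[ i ] f i ≡ v) → count p ≤ m
count-image {m} f p p⊆f = count≤ m p λ g g-inj pg →
  1+n≰n (injective⇒≤ {f = λ i → proj₁ (p⊆f (g i) (pg i))}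
    (λ {i} {j} e → g-inj (trans (sym (proj₂ (p⊆f (g i) (pg i))))
      (trans (cong f e) (proj₂ (p⊆f (g j) (pg j)))))))

-- κ colours the vertices with m-bit colours.
ClassesBounded : ∀ {m n} → (Fin m → Fin n → Bool) → (Fin n → Bool) → ℕ → Set
ClassesBounded κ p t = ∀ q → (∀ x → q x ≡ true → p x ≡ true) →
  (∀ x y → q x ≡ true → q y ≡ true → ∀ j → κ j x ≡ κ j y) → count q ≤ t

-- Where the first bit is constant, the remaining bits already determine the colour.
refine : ∀ {m n} {κ : Fin (suc m) → Fin n → Bool} {p t} → ClassesBounded κ p t →
  ∀ (h : Fin n → Bool) b → (∀ x → h x ≡ true → κ zero x ≡ b) →
  ClassesBounded (κ ∘ suc) (λ x → p x ∧ h x) t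
refine {p = p} bounded h b hb q q⇒ const = bounded q (λ x qx → ∧-conicalˡ (p x) (h x) (q⇒ x qx))
  λ { x y qx qy zero    → trans (hb x (∧-conicalʳ (p x) (h x) (q⇒ x qx)))
                                (sym (hb y (∧-conicalʳ (p y) (h y) (q⇒ y qy))))
    ; x y qx qy (suc j) → const x y qx qy j }

not-true : ∀ {b} → not b ≡ true → b ≡ false
not-true {false} _ = refl

double : ∀ t m → t * 2 ^ m + t * 2 ^ m ≡ t * 2 ^ suc m
double t m = trans (sym (*-distribˡ-+ t (2 ^ m) (2 ^ m)))
  (cong (λ k → t * (2 ^ m + k)) (sym (+-identityʳ (2 ^ m))))

count-classes : ∀ {n} m (κ : Fin m → Fin n → Bool) (p : Fin n → Bool) t →
  ClassesBounded κ p t → count p ≤ t * 2 ^ m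
count-classes zero    κ p t bounded =
  ≤-trans (bounded p (λ _ px → px) (λ _ _ _ _ ())) (≤-reflexive (sym (*-identityʳ t)))
count-classes (suc m) κ p t bounded = begin
  count p
    ≡⟨ count-split p (κ zero) ⟩
  count (λ x → p x ∧ κ zero x) + count (λ x → p x ∧ not (κ zero x))
    ≤⟨ +-mono-≤
         (count-classes m (κ ∘ suc) _ t (refine {κ = κ} {p} bounded (κ zero) true (λ x e → e)))
         (count-classes m (κ ∘ suc) _ t (refine {κ = κ} {p} bounded (not ∘ κ zero) false (λ x → not-true))) ⟩
  t * 2 ^ m + t * 2 ^ m
    ≡⟨ double t m ⟩
  t * 2 ^ suc m ∎
  where open ≤-Reasoning

-- Only 2^m - 1 colours occur; the `+ t` stands for the absent zero colour and avoids a subtraction.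
-- Vertices whose first bit is set may have any remaining bits, while the others need a nonzero
-- remainder, so the recursion continues only on the latter.
count-nonzero-classes : ∀ {n} m (κ : Fin m → Fin n → Bool) (p : Fin n → Bool) t →
  (∀ x → p x ≡ true → ∃[ j ] κ j x ≡ true) →
  ClassesBounded κ p t → count p + t ≤ t * 2 ^ m
count-nonzero-classes zero κ p t nonzero bounded =
  ≤-reflexive (trans (cong (_+ t) (count-none (λ x px → ¬Fin0 (proj₁ (nonzero x px)))))
    (sym (*-identityʳ t)))
count-nonzero-classes (suc m) κ p t nonzero bounded = begin
  count p + t
    ≡⟨ cong (_+ t) (count-split p (κ zero)) ⟩
  count (λ x → p x ∧ κ zero x) + count (λ x → p x ∧ not (κ zero x)) + t
    ≡⟨ +-assoc (count (λ x → p x ∧ κ zero x)) _ t ⟩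
  count (λ x → p x ∧ κ zero x) + (count (λ x → p x ∧ not (κ zero x)) + t)
    ≤⟨ +-mono-≤
         (count-classes m (κ ∘ suc) _ t (refine {κ = κ} {p} bounded (κ zero) true (λ x e → e)))
         (count-nonzero-classes m (κ ∘ suc) _ t nonzero′
           (refine {κ = κ} {p} bounded (not ∘ κ zero) false (λ x → not-true))) ⟩
  t * 2 ^ m + t * 2 ^ m
    ≡⟨ double t m ⟩
  t * 2 ^ suc m ∎
  where
  open ≤-Reasoning
  nonzero′ : ∀ x → p x ∧ not (κ zero x) ≡ true → ∃[ j ] κ (suc j) x ≡ true
  nonzero′ x px with nonzero x (∧-conicalˡ _ _ px)
  ... | suc j , e = j , e
  ... | zero , e with trans (sym e) (not-true (∧-conicalʳ _ _ px))
  ...   | ()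

-- From exchanges back to pivots

transform-empty : ∀ {n} {G G′ : Graph n} {X} → (∀ i → X i ≡ false) → Transform G X G′ →
  ∀ x y → adj G x y ≡ adj G′ x y
transform-empty {G = G} {G′} X≗ T x y = trans (sym (·-ind (adj G x) y))
  (trans (sym (Transform.exchange (transform-resp X≗ T) (ind y) x)) (·-ind (adj G′ x) y))

-- If u had no neighbour in `X`, exchanging `ind u` with its image would give the zero vector: on
-- `X` its entries are adjacencies to u, and off `X` they are those of `ind u`. But `G′` would have
-- to send it to a vector with entry 1 at u.
transform⇒edge : ∀ {n} {G G′ : Graph n} {X} → Transform G X G′ →
  ∀ u → X u ≡ true → ∃[ v ] X v ≡ true × Edge G u v
transform⇒edge {G = G} {G′} {X} T u Xu with any? (λ v → (X v ∧ adj G u v) ≟ᵇ true)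
... | yes (v , e) = v , ∧-conicalˡ _ _ e , ∧-conicalʳ _ _ e
... | no none = contradiction false≡true λ ()
  where
  y : Fin _ → Bool
  y = G ⊛ ind u

  x′≗ : ∀ j → select X (ind u) y j ≡ false
  x′≗ j with X j in Xj
  ... | true  = trans (·-ind (adj G j) u) (trans (adj-sym G j u)
        (¬-not (λ uj → none (j , cong₂ _∧_ Xj uj))))
  ... | false = ind-≢ {u = u} {j} λ { refl → contradiction (trans (sym Xj) Xu) λ () }

  false≡true : false ≡ true
  false≡true = begin
    false                        ≡⟨ ·-zeroˡ (adj G′ u) x′≗ ⟨
    select X (ind u) y · adj G′ u ≡⟨ ·-comm (select X (ind u) y) (adj G′ u) ⟩
    (G′ ⊛ select X (ind u) y) u  ≡⟨ Transform.exchange T (ind u) u ⟩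
    select X y (ind u) u         ≡⟨ cong (λ b → if b then ind u u else y u) Xu ⟩
    ind u u                      ≡⟨ ind-refl u ⟩
    true ∎
    where open ≡-Reasoning

-- While `X` is nonempty it contains both ends of some edge uv. Pivot uv and precompose the exchange
-- with the inverse pivot: what remains is an exchange on `X` without u and v, so `fuel` can bound
-- the size of `X`. When `X` is empty the graph equals `G′`.
data⇒hasPivotMinor : ∀ {n k} {G : Graph n} {H : Graph k} → PivotMinorData G H → HasPivotMinor G H
data⇒hasPivotMinor {n} {k} {H = H} (mk X₀ G′ T₀ f (f-inj , f-adj)) =
  go (suc (count X₀)) _ X₀ ≤-refl T₀
  where
  go : ∀ fuel (G : Graph n) X → count X < fuel → Transform G X G′ → HasPivotMinor G H
  go (suc fuel) G X X< T with any? (λ u → X u ≟ᵇ true)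
  ... | no none = embeds⇒hasPivotMinor {H = H} {G} f
        (f-inj , λ x y → trans (f-adj x y)
          (sym (transform-empty (λ i → ¬-not (λ Xi → none (i , Xi))) T (f x) (f y))))
  ... | yes (u , Xu) with transform⇒edge T u Xu
  ...   | v , Xv , uv = hasPivotMinor-obtained {K = H} (pivot start u v uv)
          (go fuel (edgePivot G u v uv) (pair u v △ X)
            (≤-trans (count-mono-< smaller u uX Xu) (s≤s⁻¹ X<))
            (transform-trans (transform-edgePivot⁻¹ G u v uv) T))
    where
    uX : (pair u v △ X) u ≡ false
    uX rewrite ind-refl u | ind-≢ (edge⇒≢ G uv ∘ sym) | Xu = refl

    smaller : ∀ i → (pair u v △ X) i ≡ true → X i ≡ true
    smaller i e with u ≟ i | v ≟ i
    ... | yes refl | _        = Xu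
    ... | no _     | yes refl = Xv
    ... | no _     | no _     = e

-- Minimal graphs

embeds-resp : ∀ {k n} {H : Graph k} {G G′ : Graph n} {f} → Embeds H G f →
  (∀ x y → adj G′ (f x) (f y) ≡ adj G (f x) (f y)) → Embeds H G′ f
embeds-resp (f-inj , f-adj) eq = f-inj , λ x y → trans (f-adj x y) (sym (eq x y))

-- A vertex off X can be deleted before the pivots instead of after them.
minimal⇒hit : ∀ {n k} {G : Graph n} {H : Graph k} → InducedSubgraphMinimal G H →
  ∀ {X G′ f} → Transform G X G′ → Embeds H G′ f → ∀ v → X v ≡ false → ∃[ i ] f i ≡ v
minimal⇒hit {suc n} {H = H} (_ , minimal) {X} {G′} {f} T e v Xv with any? (λ i → f i ≟ v)
... | yes v∈f = v∈f
... | no v∉f  = contradiction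
  (data⇒hasPivotMinor (mk (X ∘ punchIn v) (deleteVertex G′ v) (transform-delete v Xv T) _
    (embeds-delete e (λ i v≡fi → v∉f (i , sym v≡fi)))))
  (minimal ≤-refl (mk↣ (punchIn-injective v _ _)))

-- Copies of P₂ + tP₁

module _ {t : ℕ} where

  private
    P : Graph (2 + t)
    P = P₂+ t P₁

  exchange-ends : Fin (2 + t) → Fin (2 + t)
  exchange-ends zero          = suc zero
  exchange-ends (suc zero)    = zero
  exchange-ends (suc (suc i)) = suc (suc i)

  exchange-ends-involutive : ∀ i → exchange-ends (exchange-ends i) ≡ i
  exchange-ends-involutive zero          = refl
  exchange-ends-involutive (suc zero)    = refl
  exchange-ends-involutive (suc (suc i)) = refl

  exchange-ends-adj : ∀ x y → adj P x y ≡ adj P (exchange-ends x) (exchange-ends y)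
  exchange-ends-adj zero          zero          = refl
  exchange-ends-adj zero          (suc zero)    = refl
  exchange-ends-adj zero          (suc (suc _)) = refl
  exchange-ends-adj (suc zero)    zero          = refl
  exchange-ends-adj (suc zero)    (suc zero)    = refl
  exchange-ends-adj (suc zero)    (suc (suc _)) = refl
  exchange-ends-adj (suc (suc _)) zero          = refl
  exchange-ends-adj (suc (suc _)) (suc zero)    = refl
  exchange-ends-adj (suc (suc _)) (suc (suc _)) = refl

  pivotAdj-P₂ : ∀ x y → adj P x y ≡ pivotAdj P zero (suc zero) x y
  pivotAdj-P₂ zero          zero          = refl
  pivotAdj-P₂ zero          (suc zero)    = refl
  pivotAdj-P₂ zero          (suc (suc _)) = refl
  pivotAdj-P₂ (suc zero)    zero          = refl
  pivotAdj-P₂ (suc zero)    (suc zero)    = refl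
  pivotAdj-P₂ (suc zero)    (suc (suc _)) = refl
  pivotAdj-P₂ (suc (suc _)) zero          = refl
  pivotAdj-P₂ (suc (suc _)) (suc zero)    = refl
  pivotAdj-P₂ (suc (suc _)) (suc (suc _)) = refl

  open PivotMinorData

  -- If both ends lie in `X`, pivoting the edge takes both out of `X`, and by `pivotAdj-P₂` the copy
  -- survives. If only the first does, relabelling suffices.
  end-off-X : ∀ {n} {G : Graph n} → PivotMinorData G P →
    Σ[ d ∈ PivotMinorData G P ] X d (f d zero) ≡ false
  end-off-X d@(mk X G′ T f e@(f-inj , f-adj)) with X (f zero) in Xa | X (f (suc zero)) in Xb
  ... | false | _     = d , Xa
  ... | true  | false = mk X G′ T (f ∘ exchange-ends)
        ( (λ {x} {y} eq → trans (sym (exchange-ends-involutive x))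
            (trans (cong exchange-ends (f-inj eq)) (exchange-ends-involutive y)))
        , λ x y → trans (exchange-ends-adj x y) (f-adj (exchange-ends x) (exchange-ends y)))
        , Xb
  ... | true  | true  = mk (X △ pair a b) (edgePivot G′ a b ab)
        (transform-trans T (transform-edgePivot G′ a b ab)) f
        (f-inj , λ x y → trans (pivotAdj-P₂ x y) (trans (pivotAdj-embeds e zero (suc zero) x y)
          (sym (adj-edgePivot G′ a b ab (f x) (f y)))))
        , Xa′
    where
    a b : Fin _
    a = f zero
    b = f (suc zero)
    ab : Edge G′ a b
    ab = sym (f-adj zero (suc zero))

    Xa′ : (X △ pair a b) a ≡ false
    Xa′ rewrite Xa | ind-refl a | ind-≢ (edge⇒≢ G′ ab ∘ sym) = refl

  edgeAndIsolated : ∀ {n} → Fin n → Fin n → (Fin t → Fin n) → Fin (2 + t) → Fin n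
  edgeAndIsolated u v e zero          = u
  edgeAndIsolated u v e (suc zero)    = v
  edgeAndIsolated u v e (suc (suc i)) = e i

  edgeAndIsolated-embeds : ∀ {n} (G : Graph n) {u v} {e : Fin t → Fin n} → Edge G u v →
    Injective _≡_ _≡_ e → (∀ i j → adj G (e i) (e j) ≡ false) →
    (∀ i → adj G u (e i) ≡ false) → (∀ i → adj G v (e i) ≡ false) →
    Embeds P G (edgeAndIsolated u v e)
  edgeAndIsolated-embeds {n} G {u} {v} {e} uv e-inj ee ue ve = inj , adj≡
    where
    vu : Edge G v u
    vu = trans (adj-sym G v u) uv

    u≢e : ∀ i → u ≢ e i
    u≢e i refl = contradiction (trans (sym vu) (ve i)) λ ()

    v≢e : ∀ i → v ≢ e i
    v≢e i refl = contradiction (trans (sym uv) (ue i)) λ ()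

    inj : Injective _≡_ _≡_ (edgeAndIsolated u v e)
    inj {zero}        {zero}        _  = refl
    inj {zero}        {suc zero}    eq = contradiction eq (edge⇒≢ G uv)
    inj {zero}        {suc (suc i)} eq = contradiction eq (u≢e i)
    inj {suc zero}    {zero}        eq = contradiction eq (edge⇒≢ G vu)
    inj {suc zero}    {suc zero}    _  = refl
    inj {suc zero}    {suc (suc i)} eq = contradiction eq (v≢e i)
    inj {suc (suc i)} {zero}        eq = contradiction (sym eq) (u≢e i)
    inj {suc (suc i)} {suc zero}    eq = contradiction (sym eq) (v≢e i)
    inj {suc (suc i)} {suc (suc j)} eq = cong (λ k → suc (suc k)) (e-inj eq)

    adj≡ : ∀ x y → adj P x y ≡ adj G (edgeAndIsolated u v e x) (edgeAndIsolated u v e y)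
    adj≡ zero          zero          = sym (irrefl G u)
    adj≡ zero          (suc zero)    = sym uv
    adj≡ zero          (suc (suc i)) = sym (ue i)
    adj≡ (suc zero)    zero          = sym vu
    adj≡ (suc zero)    (suc zero)    = sym (irrefl G v)
    adj≡ (suc zero)    (suc (suc i)) = sym (ve i)
    adj≡ (suc (suc i)) zero          = sym (trans (adj-sym G (e i) u) (ue i))
    adj≡ (suc (suc i)) (suc zero)    = sym (trans (adj-sym G (e i) v) (ve i))
    adj≡ (suc (suc i)) (suc (suc j)) = sym (ee i j)

does⇒ : ∀ {A : Set} (d : Dec A) → does d ≡ true → A
does⇒ (yes x) _ = x

not-does⇒ : ∀ {A : Set} (d : Dec A) → not (does d) ≡ true → ¬ A
not-does⇒ (no ¬x) _ = ¬x

Independent : ∀ {k n} → Graph n → (Fin k → Fin n) → Set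
Independent G e = Injective _≡_ _≡_ e × (∀ i j → adj G (e i) (e j) ≡ false)

-- Vertices outside the copy

module Argument {t n} {G : Graph n} (minimal : InducedSubgraphMinimal G (P₂+ t P₁))
  {X} {G′ : Graph n} (T : Transform G X G′) {f} (f-embeds : Embeds (P₂+ t P₁) G′ f)
  (Xa : X (f zero) ≡ false) where

  open Embeds f-embeds renaming (injective to f-inj; adj-≡ to f-adj)

  a : Fin n
  a = f zero

  r : Fin (suc t) → Fin n
  r = f ∘ suc

  Outside : Fin n → Set
  Outside v = ∀ i → f i ≢ v

  outside⇒≢a : ∀ {v} → Outside v → a ≢ v
  outside⇒≢a W = W zero

  r≢a : ∀ j → a ≢ r j
  r≢a j eq with f-inj eq
  ... | ()

  outside⇒X : ∀ {v} → Outside v → X v ≡ true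
  outside⇒X {v} W with X v in Xv
  ... | true = refl
  ... | false with minimal⇒hit minimal T f-embeds v Xv
  ...   | i , fi≡v = contradiction fi≡v (W i)

  -- As `a` is off `Y`, minimality puts `a` into every copy in `G″`. The bounds below are obtained
  -- by building a copy without it.
  no-edgeAndIsolated : ∀ {Y G″} → Transform G Y G″ → Y a ≡ false →
    ∀ {u v} {e : Fin t → Fin n} → a ≢ u → a ≢ v → (∀ i → a ≢ e i) → Edge G″ u v →
    Independent G″ e → (∀ i → adj G″ u (e i) ≡ false) → (∀ i → adj G″ v (e i) ≡ false) → ⊥
  no-edgeAndIsolated {G″ = G″} T′ Ya a≢u a≢v a≢e uv (e-inj , ee) ue ve
    with minimal⇒hit minimal T′ (edgeAndIsolated-embeds G″ uv e-inj ee ue ve) a Ya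
  ... | zero          , eq = a≢u (sym eq)
  ... | suc zero      , eq = a≢v (sym eq)
  ... | suc (suc i)   , eq = a≢e i (sym eq)

  pvec-outside : ∀ {w} → Outside w → ∀ i → pvec G′ w (f i) ≡ adj G′ w (f i)
  pvec-outside W i = trans (cong (adj G′ _ (f i) xor_) (ind-≢ (W i ∘ sym))) (xor-identityʳ _)

  -- Otherwise pivoting uv would leave the copy of P₂ + tP₁ unchanged, and u
  -- would not be needed.
  outside-edge : ∀ {u v} → Outside u → Outside v → Edge G′ u v →
    (∀ x y → adj G′ u (f x) ∧ adj G′ v (f y) xor adj G′ v (f x) ∧ adj G′ u (f y) ≡ false) → ⊥
  outside-edge {u} {v} Wu Wv uv unchanged =
    Wu (proj₁ hit) (proj₂ hit)
    where
    Yu : (X △ pair u v) u ≡ false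
    Yu rewrite outside⇒X Wu | ind-refl u | ind-≢ (edge⇒≢ G′ uv ∘ sym) = refl

    adj≡ : ∀ x y → adj (edgePivot G′ u v uv) (f x) (f y) ≡ adj G′ (f x) (f y)
    adj≡ x y = begin
      adj (edgePivot G′ u v uv) (f x) (f y)
        ≡⟨ adj-edgePivot G′ u v uv (f x) (f y) ⟩
      pivotAdj G′ u v (f x) (f y)
        ≡⟨ cong (adj G′ (f x) (f y) xor_) (cong₂ _xor_
             (cong₂ _∧_ (pvec-outside Wu x) (pvec-outside Wv y))
             (cong₂ _∧_ (pvec-outside Wv x) (pvec-outside Wu y))) ⟩
      adj G′ (f x) (f y) xor (adj G′ u (f x) ∧ adj G′ v (f y) xor adj G′ v (f x) ∧ adj G′ u (f y))
        ≡⟨ cong (adj G′ (f x) (f y) xor_) (unchanged x y) ⟩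
      adj G′ (f x) (f y) xor false
        ≡⟨ xor-identityʳ _ ⟩
      adj G′ (f x) (f y) ∎
      where open ≡-Reasoning

    hit : ∃[ i ] f i ≡ u
    hit = minimal⇒hit minimal (transform-trans T (transform-edgePivot G′ u v uv))
      (embeds-resp {G = G′} {edgePivot G′ u v uv} f-embeds adj≡) u Yu

  -- If rows u and v agree on the copy, the two terms of the rank-two correction are equal there and
  -- cancel.
  same-type⇒nonadjacent : ∀ {u v} → Outside u → Outside v →
    (∀ i → adj G′ u (f i) ≡ adj G′ v (f i)) → adj G′ u v ≡ false
  same-type⇒nonadjacent {u} {v} Wu Wv same = ¬-not λ uv → outside-edge Wu Wv uv λ x y →
    trans (cong₂ _xor_ (cong (adj G′ u (f x) ∧_) (sym (same y)))
                       (cong (_∧ adj G′ u (f y)) (sym (same x))))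
      (xor-same (adj G′ u (f x) ∧ adj G′ u (f y)))

  -- Since w lies in `X`, row w of `G′` recovers the coordinate x w from the exchanged vector.
  -- Applied to unit vectors, this shows below that such rows are neither trivial nor repeated.
  row : ∀ {w} → Outside w → ∀ x → (G′ ⊛ select X x (G ⊛ x)) w ≡ x w
  row {w} W x = trans (Transform.exchange T x w)
    (cong (λ b → if b then x w else (G ⊛ x) w) (outside⇒X W))

  -- Exchange `ind w` with its image. The result is 0 at `a`, as `a` is off `X` and differs from w;
  -- so if w had no neighbour but possibly `a`, row w would give 0, whereas `row` gives 1.
  outside⇒neighbour : ∀ {w} → Outside w → ∃[ y ] a ≢ y × Edge G′ w y
  outside⇒neighbour {w} W with any? (λ y → (not (ind a y) ∧ adj G′ w y) ≟ᵇ true)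
  ... | yes (y , e) = y
    , (λ { refl → contradiction (trans (sym (ind-refl a)) (not-true (∧-conicalˡ _ _ e))) λ () })
    , ∧-conicalʳ _ _ e
  ... | no none = contradiction
          (trans (sym (·-disjoint (adj G′ w) x′ disjoint)) (trans (row W (ind w)) (ind-refl w))) λ ()
    where
    x′ : Fin n → Bool
    x′ = select X (ind w) (G ⊛ ind w)

    x′a : x′ a ≡ false
    x′a rewrite Xa = ind-≢ (outside⇒≢a W ∘ sym)

    disjoint : ∀ y → adj G′ w y ∧ x′ y ≡ false
    disjoint y = by (a ≟ y)
      where
      by : Dec (a ≡ y) → adj G′ w y ∧ x′ y ≡ false
      by (yes refl) = trans (cong (adj G′ w a ∧_) x′a) (∧-zeroʳ _)
      by (no a≢y)   = cong (_∧ x′ y) (¬-not λ wy → none (y , cong₂ _∧_ (cong not (ind-≢ a≢y)) wy))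

  -- With equal rows, the vector exchanged from `ind w` would yield both `ind w w` and `ind w w′`.
  distinct-rows : ∀ {w w′} → Outside w → Outside w′ → w ≢ w′ →
    ∃[ y ] adj G′ w y ≢ adj G′ w′ y
  distinct-rows {w} {w′} W W′ w≢w′ with all? (λ y → adj G′ w y ≟ᵇ adj G′ w′ y)
  ... | no differ = ¬∀⟶∃¬ n _ (λ y → adj G′ w y ≟ᵇ adj G′ w′ y) differ
  ... | yes same  = contradiction (begin
      true                                          ≡⟨ ind-refl w ⟨
      ind w w                                       ≡⟨ row W (ind w) ⟨
      (G′ ⊛ select X (ind w) (G ⊛ ind w)) w         ≡⟨ ·-cong same (λ _ → refl) ⟩
      (G′ ⊛ select X (ind w) (G ⊛ ind w)) w′        ≡⟨ row W′ (ind w) ⟩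
      ind w w′                                      ≡⟨ ind-≢ w≢w′ ⟩
      false ∎) λ ()
    where open ≡-Reasoning

  -- Pivoting s with one common neighbour e₀ makes sr an edge (or keeps it
  -- one) and isolates the remaining common neighbours from s and r.
  no-common-neighbours : ∀ {s r} {e : Fin (suc t) → Fin n} → s ≢ r →
    a ≢ s → a ≢ r → (∀ i → a ≢ e i) → Independent G′ e →
    (∀ i → Edge G′ s (e i)) → (∀ i → Edge G′ r (e i)) → ⊥
  no-common-neighbours {s} {r} {e} s≢r a≢s a≢r a≢e (e-inj , ee) se re =
    no-edgeAndIsolated (transform-trans T (transform-edgePivot G′ s e₀ (se zero))) Ya a≢s a≢r
      (a≢e ∘ suc) sr
      ((λ eq → suc-injective (e-inj eq)) , λ i j → trans (piv (e (suc i)) (e (suc j)))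
        (formula (ee (suc i) (suc j)) (αe i) (βe j) (βe i) (αe j)))
      (λ i → trans (piv s (e (suc i))) (formula (se (suc i)) αs (βe i) βs (αe i)))
      (λ i → trans (piv r (e (suc i))) (trans (formula (re (suc i)) refl (βe i) βr (αe i))
        (cong (λ b → true xor (b xor true)) (∧-zeroʳ (pvec G′ s r)))))
    where
    e₀ : Fin n
    e₀ = e zero

    Ya : (X △ pair s e₀) a ≡ false
    Ya rewrite Xa | ind-≢ (a≢s ∘ sym) | ind-≢ (a≢e zero ∘ sym) = refl

    piv : ∀ x y → adj (edgePivot G′ s e₀ (se zero)) x y ≡ pivotAdj G′ s e₀ x y
    piv = adj-edgePivot G′ s e₀ (se zero)

    formula : ∀ {x y c α β β′ α′} → adj G′ x y ≡ c → pvec G′ s x ≡ α → pvec G′ e₀ y ≡ β →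
      pvec G′ e₀ x ≡ β′ → pvec G′ s y ≡ α′ →
      pivotAdj G′ s e₀ x y ≡ c xor (α ∧ β xor β′ ∧ α′)
    formula refl refl refl refl refl = refl

    αs : pvec G′ s s ≡ true
    αs = cong₂ _xor_ (irrefl G′ s) (ind-refl s)

    αe : ∀ i → pvec G′ s (e (suc i)) ≡ true
    αe i = cong₂ _xor_ (se (suc i)) (ind-≢ (edge⇒≢ G′ (se (suc i))))

    βs : pvec G′ e₀ s ≡ true
    βs = cong₂ _xor_ (trans (adj-sym G′ e₀ s) (se zero)) (ind-≢ (edge⇒≢ G′ (se zero) ∘ sym))

    βr : pvec G′ e₀ r ≡ true
    βr = cong₂ _xor_ (trans (adj-sym G′ e₀ r) (re zero)) (ind-≢ (edge⇒≢ G′ (re zero) ∘ sym))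

    βe : ∀ i → pvec G′ e₀ (e (suc i)) ≡ false
    βe i = cong₂ _xor_ (ee zero (suc i)) (ind-≢ (λ eq → 0≢1+n (e-inj eq)))

    -- Whether s and r are adjacent before the pivot is unknown; in `sr` this entry cancels against
    -- itself, and elsewhere it is multiplied by 0.
    αr : pvec G′ s r ≡ adj G′ s r
    αr = trans (cong (adj G′ s r xor_) (ind-≢ s≢r)) (xor-identityʳ _)

    sr : adj (edgePivot G′ s e₀ (se zero)) s r ≡ true
    sr = trans (piv s r) (trans (formula refl αs βr βs αr) (b (adj G′ s r)))
      where
      b : ∀ c → c xor (true ∧ true xor true ∧ c) ≡ true
      b true  = refl
      b false = refl

  -- Otherwise row w vanishes on the copy, so a neighbour y of w is outside too. Pivoting wy then
  -- changes nothing on the copy, against `outside-edge`.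
  a-edge : ∀ {w} → Outside w → (∀ j → adj G′ w (r j) ≡ false) → Edge G′ w a
  a-edge {w} W none with adj G′ w a in wa
  ... | true  = refl
  ... | false with outside⇒neighbour W
  ...   | y , _ , wy = ⊥-elim (outside-edge W Wy wy λ x z →
            cong₂ _xor_ (cong (_∧ adj G′ y (f z)) (wf x))
              (trans (cong (adj G′ y (f x) ∧_) (wf z)) (∧-zeroʳ _)))
    where
    wf : ∀ i → adj G′ w (f i) ≡ false
    wf zero    = wa
    wf (suc j) = none j

    Wy : Outside y
    Wy i refl = contradiction (trans (sym wy) (wf i)) λ ()

  -- The t + 1 vertices of `r` are independent. If `r j` were the only one adjacent to w, then w,
  -- `r j` and the other t would already be a copy in `G′` avoiding `a`.
  second-neighbour : ∀ {w} → Outside w → ∀ j → Edge G′ w (r j) →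
    ∃[ k ] j ≢ k × Edge G′ w (r k)
  second-neighbour {w} W j wj with any? (λ i → adj G′ w (r (punchIn j i)) ≟ᵇ true)
  ... | yes (i , wi) = punchIn j i , (λ eq → punchInᵢ≢i j i (sym eq)) , wi
  ... | no none = ⊥-elim (no-edgeAndIsolated T Xa (outside⇒≢a W) (r≢a j)
          (λ i → r≢a (punchIn j i)) wj
          ( (λ eq → punchIn-injective j _ _ (suc-injective (f-inj eq)))
          , λ i k → rr (punchIn j i) (punchIn j k))
          (λ i → ¬-not λ wi → none (i , wi)) (λ i → rr j (punchIn j i)))
    where
    rr : ∀ i k → adj G′ (r i) (r k) ≡ false
    rr i k = trans (sym (f-adj (suc i) (suc k))) (P-rr i k)
      where
      P-rr : ∀ i k → adj (P₂+ t P₁) (suc i) (suc k) ≡ false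
      P-rr zero    zero    = refl
      P-rr zero    (suc k) = refl
      P-rr (suc i) zero    = refl
      P-rr (suc i) (suc k) = refl

  class-bound : ∀ q → (∀ w → q w ≡ true → Outside w × ∃[ j ] Edge G′ w (r j)) →
    (∀ w w′ → q w ≡ true → q w′ ≡ true → ∀ i → adj G′ w (f i) ≡ adj G′ w′ (f i)) →
    count q ≤ t
  class-bound q q⇒ same = count≤ t q λ g g-inj qg →
    let W i = proj₁ (q⇒ (g i) (qg i))
        j , gj = proj₂ (q⇒ (g zero) (qg zero))
        k , j≢k , gk = second-neighbour (W zero) j gj
        common l e i = trans (adj-sym G′ (r l) (g i))
          (trans (same (g i) (g zero) (qg i) (qg zero) (suc l)) e)
    in no-common-neighbours {s = r j} {r = r k} {e = g} (λ eq → j≢k (suc-injective (f-inj eq)))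
         (r≢a j) (r≢a k) (λ i → outside⇒≢a (W i))
         (g-inj , λ i i′ → same-type⇒nonadjacent (W i) (W i′) (same (g i) (g i′) (qg i) (qg i′)))
         (common j gj) (common k gk)

  -- Each of y and y′ misses fewer than t vertices of the independent set, so
  -- they have at least t + 1 common neighbours in it.
  no-large-independent : ∀ {s} → t ≡ suc s → (g : Fin (suc (suc (3 * s))) → Fin n) →
    Independent G′ g → (∀ i → a ≢ g i) →
    ∀ {y y′} → y ≢ y′ → a ≢ y → a ≢ y′ →
    ∀ i i′ → Edge G′ y (g i) → Edge G′ y′ (g i′) → ⊥
  no-large-independent {s} refl g (g-inj , gg) a≢g {y} {y′} y≢y′ a≢y a≢y′ i i′ yi y′i′
    with count⇒injection (suc t) (λ k → N y k ∧ N y′ k) enough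
    where
    N : Fin n → Fin (suc (suc (3 * s))) → Bool
    N y k = adj G′ y (g k)

    -- Any t = s + 1 missed vertices, together with the edge from y to `g i`, would form a copy in
    -- `G′` avoiding `a`.
    missed : ∀ {y} → a ≢ y → ∀ i → Edge G′ y (g i) → count (not ∘ N y) ≤ s
    missed {y} a≢y i yi = count≤ s (not ∘ N y) λ h h-inj yh →
      no-edgeAndIsolated T Xa {e = g ∘ h} a≢y (a≢g i) (a≢g ∘ h) yi
        ((λ eq → h-inj (g-inj eq)) , λ k l → gg (h k) (h l))
        (λ k → not-true (yh k)) (λ k → gg i (h k))

    c : ℕ
    c = count (λ k → N y k ∧ N y′ k)

    -- The size is chosen so that 3s + 2 = (t + 1) + 2s: at most s vertices are lost to y and at
    -- most s to y′.
    enough : suc t ≤ c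
    enough = +-cancelʳ-≤ (s + s) (suc t) c (begin
      suc t + (s + s)        ≡⟨ cong (λ k → suc (suc (s + (s + k)))) (sym (+-identityʳ s)) ⟩
      suc (suc (3 * s))      ≡⟨ count-true _ ⟨
      count {suc (suc (3 * s))} (λ _ → true) ≡⟨ count-split (λ _ → true) (N y) ⟩
      count (N y) + count (not ∘ N y) ≡⟨ cong (_+ count (not ∘ N y)) (count-split (N y) (N y′)) ⟩
      c + count (λ k → N y k ∧ not (N y′ k)) + count (not ∘ N y)
        ≡⟨ +-assoc c _ _ ⟩
      c + (count (λ k → N y k ∧ not (N y′ k)) + count (not ∘ N y))
        ≤⟨ +-monoʳ-≤ c (+-mono-≤
             (≤-trans (count-mono {q = not ∘ N y′} (λ k → ∧-conicalʳ (N y k) (not (N y′ k))))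
                (missed a≢y′ i′ y′i′))
             (missed a≢y i yi)) ⟩
      c + (s + s) ∎)
      where open ≤-Reasoning
  ... | h , h-inj , both = no-common-neighbours {e = g ∘ h} y≢y′ a≢y a≢y′ (a≢g ∘ h)
        ((λ eq → h-inj (g-inj eq)) , λ k l → gg (h k) (h l))
        (λ k → ∧-conicalˡ _ _ (both k)) (λ k → ∧-conicalʳ (adj G′ y (g (h k))) _ (both k))

  -- By `a-edge` all members see exactly `a` in the copy, hence they are independent. Among 3s + 2
  -- members, two have different rows; a vertex y distinguishing them and a neighbour y′ of the one
  -- not adjacent to y contradict `no-large-independent`.
  a-class-bound : ∀ {s} → t ≡ suc s → ∀ q →
    (∀ w → q w ≡ true → Outside w × (∀ j → adj G′ w (r j) ≡ false)) →
    count q ≤ suc (3 * s)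
  a-class-bound {s} t≡ q q⇒ = count≤ (suc (3 * s)) q contra
    where
    contra : ∀ (g : Fin (suc (suc (3 * s))) → Fin n) → Injective _≡_ _≡_ g →
      (∀ i → q (g i) ≡ true) → ⊥
    contra g g-inj qg = by (distinct-rows (W zero) (W (suc zero)) (λ eq → 0≢1+n (g-inj eq)))
      where
      W : ∀ i → Outside (g i)
      W i = proj₁ (q⇒ (g i) (qg i))

      ga : ∀ i → Edge G′ (g i) a
      ga i = a-edge (W i) (proj₂ (q⇒ (g i) (qg i)))

      same : ∀ i i′ x → adj G′ (g i) (f x) ≡ adj G′ (g i′) (f x)
      same i i′ zero    = trans (ga i) (sym (ga i′))
      same i i′ (suc j) = trans (proj₂ (q⇒ (g i) (qg i)) j) (sym (proj₂ (q⇒ (g i′) (qg i′)) j))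

      distinguished : ∀ i i′ {y} → Edge G′ (g i) y → adj G′ (g i′) y ≡ false → ⊥
      distinguished i i′ {y} iy i′y with outside⇒neighbour (W i′)
      ... | y′ , a≢y′ , i′y′ = no-large-independent t≡ g
        (g-inj , λ k l → same-type⇒nonadjacent (W k) (W l) (same k l))
        (λ k → outside⇒≢a (W k))
        -- Member `g i′` is adjacent to y′ and to `a` but not to y, so y differs from both.
        {y} {y′} (λ { refl → contradiction (trans (sym i′y′) i′y) λ () })
        (λ { refl → contradiction (trans (sym (ga i′)) i′y) λ () }) a≢y′
        i i′ (trans (adj-sym G′ y (g i)) iy) (trans (adj-sym G′ y′ (g i′)) i′y′)

      by : ∃[ y ] adj G′ (g zero) y ≢ adj G′ (g (suc zero)) y → ⊥
      by (y , differ) with adj G′ (g zero) y in e₀ | adj G′ (g (suc zero)) y in e₁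
      ... | true  | true  = differ refl
      ... | false | false = differ refl
      ... | true  | false = distinguished zero (suc zero) e₀ e₁
      ... | false | true  = distinguished (suc zero) zero e₁ e₀

  -- Counting the groups

  inside : Fin n → Bool
  inside v = does (any? (λ i → f i ≟ v))

  meets-r : Fin n → Bool
  meets-r v = does (any? (λ j → adj G′ v (r j) ≟ᵇ true))

  inside⇒ : ∀ {v} → inside v ≡ true → ∃[ i ] f i ≡ v
  inside⇒ {v} = does⇒ (any? (λ i → f i ≟ v))

  outside⇒ : ∀ {v} → not (inside v) ≡ true → Outside v
  outside⇒ {v} e i fi≡v = not-does⇒ (any? (λ i → f i ≟ v)) e (i , fi≡v)

  meets⇒ : ∀ {v} → meets-r v ≡ true → ∃[ j ] Edge G′ v (r j)
  meets⇒ {v} = does⇒ (any? (λ j → adj G′ v (r j) ≟ᵇ true))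

  misses⇒ : ∀ {v} → not (meets-r v) ≡ true → ∀ j → adj G′ v (r j) ≡ false
  misses⇒ {v} e j = ¬-not λ vj → not-does⇒ (any? (λ j → adj G′ v (r j) ≟ᵇ true)) e (j , vj)

  meeting missing : Fin n → Bool
  meeting v = not (inside v) ∧ meets-r v
  missing v = not (inside v) ∧ not (meets-r v)

  colour : Fin (2 + t) → Fin n → Bool
  colour i v = adj G′ v (f i)

  meeting-bounded : ClassesBounded colour meeting t
  meeting-bounded q q⇒ const = class-bound q
    (λ w qw → outside⇒ (∧-conicalˡ (not (inside w)) _ (q⇒ w qw))
            , meets⇒ (∧-conicalʳ (not (inside w)) _ (q⇒ w qw)))
    const

  -- Bit zero of the colour is adjacency to `a`. For each of its two values the bits on `r` are not
  -- all zero, which excludes one group of up to t vertices each time; hence `t + t`, kept on the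
  -- left to avoid a subtraction.
  count-meeting : count meeting + (t + t) ≤ t * 2 ^ (2 + t)
  count-meeting = begin
    count meeting + (t + t)
      ≡⟨ cong (_+ (t + t)) (count-split meeting (colour zero)) ⟩
    A + B + (t + t)
      ≡⟨ interchange A B t t ⟩
    (A + t) + (B + t)
      ≤⟨ +-mono-≤
           (half (colour zero) true (λ x e → e))
           (half (not ∘ colour zero) false (λ x → not-true)) ⟩
    t * 2 ^ (1 + t) + t * 2 ^ (1 + t)
      ≡⟨ double t (1 + t) ⟩
    t * 2 ^ (2 + t) ∎
    where
    open ≤-Reasoning
    A B : ℕ
    A = count (λ x → meeting x ∧ colour zero x)
    B = count (λ x → meeting x ∧ not (colour zero x))

    half : ∀ (h : Fin n → Bool) b → (∀ x → h x ≡ true → colour zero x ≡ b) →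
      count (λ x → meeting x ∧ h x) + t ≤ t * 2 ^ (1 + t)
    half h b hb = count-nonzero-classes (1 + t) (colour ∘ suc) (λ x → meeting x ∧ h x) t
      (λ x e → meets⇒ (∧-conicalʳ (not (inside x)) _ (∧-conicalˡ (meeting x) _ e)))
      (refine {κ = colour} {meeting} meeting-bounded h b hb)

  order-bound : ∀ {s} → t ≡ suc s → n + (t + t) ≤ (2 + t) + t * 2 ^ (2 + t) + suc (3 * s)
  order-bound {s} t≡ = begin
    n + (t + t)
      ≡⟨ cong (_+ (t + t)) (trans (sym (count-true n)) (trans (count-split (λ _ → true) inside)
           (cong (count inside +_) (count-split (not ∘ inside) meets-r)))) ⟩
    count inside + (count meeting + count missing) + (t + t)
      ≡⟨ rearrange (count inside) (count meeting) (count missing) (t + t) ⟩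
    count inside + (count meeting + (t + t)) + count missing
      ≤⟨ +-mono-≤ (+-mono-≤ (count-image f inside (λ v → inside⇒)) count-meeting)
           (a-class-bound t≡ missing λ w e →
             outside⇒ (∧-conicalˡ (not (inside w)) _ e) , misses⇒ (∧-conicalʳ (not (inside w)) _ e)) ⟩
    (2 + t) + t * 2 ^ (2 + t) + suc (3 * s) ∎
    where
    open ≤-Reasoning
    open +-*-Solver
    rearrange : ∀ a b c d → a + (b + c) + d ≡ a + (b + d) + c
    rearrange = solve 4 (λ a b c d → a :+ (b :+ c) :+ d := a :+ (b :+ d) :+ c) refl

-- The arithmetic of the bound

quadratic≤exponential : ∀ s → s * s + 7 * s + 8 ≤ 2 ^ (3 + s)
quadratic≤exponential zero    = ≤-refl
quadratic≤exponential (suc s) = begin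
  suc s * suc s + 7 * suc s + 8
    -- Doubling the polynomial at s exceeds its value at s + 1 by s² + 5s; at s = 0 the inequality
    -- is an equality.
    ≤⟨ m≤m+n _ (s * s + 5 * s) ⟩
  suc s * suc s + 7 * suc s + 8 + (s * s + 5 * s)
    ≡⟨ solve 1 (λ s →
         (con 1 :+ s) :* (con 1 :+ s) :+ con 7 :* (con 1 :+ s) :+ con 8 :+ (s :* s :+ con 5 :* s)
         := con 2 :* (s :* s :+ con 7 :* s :+ con 8)) refl s ⟩
  2 * (s * s + 7 * s + 8)
    ≤⟨ *-monoʳ-≤ 2 (quadratic≤exponential s) ⟩
  2 ^ (4 + s) ∎
  where
  open ≤-Reasoning
  open +-*-Solver

-- With K = 2^(t+2), collecting all terms other than tK leaves s² + 7s + 8, which has to fit into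
-- the one remaining K.
final-bound : ∀ s n → let t = suc s in
  n + (t + t) ≤ (2 + t) + t * 2 ^ (2 + t) + suc (3 * s) →
  n ≤ (t + 1) * (2 ^ (t + 2) ∸ t ∸ 2)
final-bound s n bound = begin
  n
    ≤⟨ m+n≤o⇒m≤o∸n n n+ ⟩
  (t + 1) * 2 ^ (t + 2) ∸ (t + 1) * (t + 2)
    ≡⟨ *-distribˡ-∸ (t + 1) (2 ^ (t + 2)) (t + 2) ⟨
  (t + 1) * (2 ^ (t + 2) ∸ (t + 2))
    ≡⟨ cong ((t + 1) *_) (sym (∸-+-assoc (2 ^ (t + 2)) t 2)) ⟩
  (t + 1) * (2 ^ (t + 2) ∸ t ∸ 2) ∎
  where
  open ≤-Reasoning
  open +-*-Solver
  t K : ℕ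
  t = suc s
  K = 2 ^ (2 + t)

  -- The subtracted product is moved to the left, so that the truncated subtraction in the goal
  -- needs no separate nonnegativity check.
  n+ : n + (t + 1) * (t + 2) ≤ (t + 1) * 2 ^ (t + 2)
  n+ = +-cancelʳ-≤ (t + t) _ _ (begin
    n + (t + 1) * (t + 2) + (t + t)
      ≡⟨ solve 3 (λ a b c → a :+ b :+ c := a :+ c :+ b) refl n ((t + 1) * (t + 2)) (t + t) ⟩
    n + (t + t) + (t + 1) * (t + 2)
      ≤⟨ +-monoˡ-≤ _ bound ⟩
    (2 + t) + t * K + suc (3 * s) + (t + 1) * (t + 2)
      ≡⟨ solve 2 (λ s K → let t = con 1 :+ s in
           (con 2 :+ t) :+ t :* K :+ (con 1 :+ con 3 :* s) :+ (t :+ con 1) :* (t :+ con 2)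
           := (s :* s :+ con 7 :* s :+ con 8) :+ t :* K :+ (t :+ t)) refl s K ⟩
    (s * s + 7 * s + 8) + t * K + (t + t)
      ≤⟨ +-monoˡ-≤ (t + t) (+-monoˡ-≤ (t * K) (quadratic≤exponential s)) ⟩
    K + t * K + (t + t)
      ≡⟨ cong₂ (λ c d → c * 2 ^ d + (t + t)) (+-comm 1 t) (+-comm 2 t) ⟩
    (t + 1) * 2 ^ (t + 2) + (t + t) ∎)

theorem4p9 : (t : ℕ) → 1 ≤ t → (n : ℕ) (G : Graph n) →
    InducedSubgraphMinimal G (P₂+ t P₁) →
    n ≤ (t + 1) * (2 ^ (t + 2) ∸ t ∸ 2)
theorem4p9 (suc s) _ n G minimal with end-off-X (hasPivotMinor⇒data (proj₁ minimal))
... | mk X G′ T f e , Xa = final-bound s n (Argument.order-bound minimal T e Xa refl)
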